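{- Let $n \ge 1$ and let $T_1=([n], E_1)$ and $T_2=([n], E_2)$ be two tournaments on the same vertex set $[n]$. Then there is a vertex $\mu \in [n]$ such that $i \Rightarrow \mu$ for every $i \in [n]$; that is, for every $i\in[n]$ at least one of the following holds: $i=\mu$, or $(i,\mu)\in E_1$, or $(i,\mu)\in E_2$, or there exists $k\in[n]$ with $(i,k)\in E_1$ and $(k,\mu)\in E_2$.
   Context: $[n]=\{1,\dots,n\}$. A tournament $T=([n],E)$ is a directed graph without loops on vertex set $[n]$ such that for every two distinct vertices $i,j$ exactly one of $(i,j)$, $(j,i)$ belongs to $E$. The tournaments $T_1$ and $T_2$ are arbitrary and need not be related. For $i,j\in[n]$, the relation $i\Rightarrow j$ (with respect to the ordered pair $(T_1,T_2)$) means: $i=j$, or $(i,j)\in E_1$, or $(i,j)\in E_2$, or there exists $k$ such that $(i,k)\in E_1$ and $(k,j)\in E_2$. -}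

module Defs where

open import Data.Nat using (ℕ)
open import Data.Fin using (Fin)
open import Data.Product using (_×_; ∃-syntax)
open import Data.Sum using (_⊎_)
open import Level using (0ℓ)
open import Relation.Binary.Core using (Rel)
open import Relation.Binary.PropositionalEquality using (_≡_; _≢_)
open import Relation.Nullary using (¬_)

-- The vertex set [n] = {1, …, n} is Fin n, and  Edge i j  says (i , j) ∈ E.
record Tournament (n : ℕ) : Set₁ where
  field
    Edge       : Rel (Fin n) 0ℓ
    loopless   : ∀ i → ¬ Edge i i
    exactlyOne : ∀ i j → i ≢ j →
                 (Edge i j × ¬ Edge j i) ⊎ (Edge j i × ¬ Edge i j)

open Tournament public using (Edge)

infix 4 _⇒[_,_]_

_⇒[_,_]_ : ∀ {n} → Fin n → Tournament n → Tournament n → Fin n → Set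
i ⇒[ T₁ , T₂ ] j =
  i ≡ j ⊎ Edge T₁ i j ⊎ Edge T₂ i j ⊎ (∃[ k ] (Edge T₁ i k × Edge T₂ k j))

{-# OPTIONS --safe #-}
module Submission where

-- If the claim fails, choose for every μ a vertex f μ with f μ ⇏ μ.  This
-- means that the closed out-neighbourhood of f μ in T₁ lies in the open
-- out-neighbourhood of μ in T₂.  Since f maps a finite set to itself, it has a
-- cycle, on which it is a bijection.  Summing the inclusions over a cycle of
-- length m and counting their members on the cycle gives
-- m(m-1)/2 + m ≤ m(m-1)/2, which is absurd.

open import Defs
open import Data.Bool using (if_then_else_)
open import Data.Fin using (Fin; zero; suc; toℕ; fromℕ; inject₁; _≟_)
open import Data.Fin.Properties using (any?; all?; pigeonhole; toℕ-fromℕ; toℕ-inject₁; ¬∀⟶∃¬)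
open import Data.Nat using (ℕ; zero; suc; _+_; _≤_; _<_; _≥_; z≤n; s≤s)
open import Data.Nat.GeneralisedArithmetic using (fold; fold-+)
open import Data.Nat.Properties using (+-0-commutativeMonoid; +-comm; +-cancelˡ-≡; +-mono-≤; +-mono-<; +-mono-<-≤; +-mono-≤-<; m≤n⇒∃[o]m+o≡n; n<1+n; <-irrefl; ≤-refl; ≤-trans; module ≤-Reasoning)
open import Data.Product using (∃-syntax; _×_; _,_; proj₁; proj₂)
open import Data.Sum using (_⊎_; inj₁; inj₂; [_,_]′)
open import Function using (_∘_; _$_)
open import Relation.Binary using (Decidable)
open import Relation.Binary.PropositionalEquality using (_≡_; refl; trans; cong; cong₂; module ≡-Reasoning)
open import Relation.Nullary using (¬_; Dec; yes; no; does; contradiction)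
open import Relation.Nullary.Decidable using (_⊎-dec_; _×-dec_)

open import Algebra.Properties.CommutativeMonoid.Sum +-0-commutativeMonoid
  using (sum; sum-syntax; sum⁺-syntax; sum-cong-≗; sum-init-last; ∑-distrib-+; ∑-comm)
open Tournament using (loopless; exactlyOne)

∑-mono-≤ : ∀ {n} {s t : Fin n → ℕ} → (∀ i → s i ≤ t i) → sum s ≤ sum t
∑-mono-≤ {zero}  s≤t = z≤n
∑-mono-≤ {suc n} s≤t = +-mono-≤ (s≤t zero) (∑-mono-≤ (s≤t ∘ suc))

∑-mono-< : ∀ {n} {s t : Fin n → ℕ} → (∀ i → s i ≤ t i) →
           (∃[ i ] (s i < t i)) → sum s < sum t
∑-mono-< s≤t (zero  , s<t) = +-mono-<-≤ s<t (∑-mono-≤ (s≤t ∘ suc))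
∑-mono-< s≤t (suc i , s<t) =
  +-mono-≤-< (s≤t zero) (∑-mono-< (s≤t ∘ suc) (i , s<t))

-- A tournament constrains only the pair of entries at (i, j) and (j, i). Exchanging the order of
-- summation turns such pairwise bounds into a bound on twice the total.
∑-symmetrise : ∀ {n} (M : Fin n → Fin n → ℕ) →
  ∑[ i < n ] ∑[ j < n ] (M i j + M j i) ≡
  ∑[ i < n ] ∑[ j < n ] M i j + ∑[ i < n ] ∑[ j < n ] M i j
∑-symmetrise {n} M = begin
  ∑[ i < n ] ∑[ j < n ] (M i j + M j i)
    ≡⟨ sum-cong-≗ (λ i → ∑-distrib-+ (M i) (λ j → M j i)) ⟩
  ∑[ i < n ] (∑[ j < n ] M i j + ∑[ j < n ] M j i)
    ≡⟨ ∑-distrib-+ (λ i → ∑[ j < n ] M i j) (λ i → ∑[ j < n ] M j i) ⟩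
  ∑[ i < n ] ∑[ j < n ] M i j + ∑[ i < n ] ∑[ j < n ] M j i
    ≡⟨ cong (∑[ i < n ] ∑[ j < n ] M i j +_) (∑-comm M) ⟨
  ∑[ i < n ] ∑[ j < n ] M i j + ∑[ i < n ] ∑[ j < n ] M i j ∎
  where open ≡-Reasoning

-- Both sums extend to the sum of `h` over 0, ..., m: one lacks the first term, the other the last,
-- and these agree.
∑-shift : ∀ m (h : ℕ → ℕ) → h m ≡ h 0 →
          ∑[ i < m ] h (suc (toℕ i)) ≡ ∑[ i < m ] h (toℕ i)
∑-shift m h hm≡h0 = +-cancelˡ-≡ (h 0) _ _ $ begin
  ∑[ i ≤ m ] h (toℕ i)
    ≡⟨ sum-init-last (λ (i : Fin (suc m)) → h (toℕ i)) ⟩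
  ∑[ i < m ] h (toℕ (inject₁ i)) + h (toℕ (fromℕ m))
    ≡⟨ cong₂ _+_ (sum-cong-≗ {m} (λ i → cong h (toℕ-inject₁ i)))
                 (trans (cong h (toℕ-fromℕ m)) hm≡h0) ⟩
  ∑[ i < m ] h (toℕ i) + h 0
    ≡⟨ +-comm _ (h 0) ⟩
  h 0 + ∑[ i < m ] h (toℕ i) ∎
  where open ≡-Reasoning

periodicPoint : ∀ {n} (f : Fin n → Fin n) → Fin n →
                ∃[ v ] ∃[ m ] (fold v f (suc m) ≡ v)
periodicPoint {n} f u
  with i , j , i<j , eq ← pigeonhole (n<1+n n) (λ k → fold u f (toℕ k))
  -- `i<j` unfolds to `suc (toℕ i) ≤ toℕ j`, so the gap between the two equal iterates is `suc m`, a
  -- positive period.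
  with m , i+m≡j ← m≤n⇒∃[o]m+o≡n i<j
  = fold u f (toℕ i) , m , (begin
    fold (fold u f (toℕ i)) f (suc m) ≡⟨ fold-+ u f (suc m) ⟨
    fold u f (suc m + toℕ i)          ≡⟨ cong (fold u f ∘ suc) (+-comm m (toℕ i)) ⟩
    fold u f (suc (toℕ i) + m)        ≡⟨ cong (fold u f) i+m≡j ⟩
    fold u f (toℕ j)                  ≡⟨ eq ⟨
    fold u f (toℕ i)                  ∎)
  where open ≡-Reasoning

-- Over a closed walk of `f`, moving the first argument one step permutes the rows, so `shift≤`
-- gives total A ≤ total B; `sym≤` and `diag<` give the reverse strictly. The period may be
-- non-minimal: sums run over positions, so repeated vertices count with multiplicity.
no-shifted-domination :
  ∀ {V : Set} (A B : V → V → ℕ) →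
  (∀ u v → B u v + B v u ≤ A u v + A v u) → (∀ v → B v v < A v v) →
  (f : V → V) → (∀ u v → A (f u) v ≤ B u v) →
  ∀ v m → ¬ fold v f (suc m) ≡ v
no-shifted-domination {V} A B sym≤ diag< f shift≤ v m period =
  <-irrefl refl (begin-strict
    total B + total B          ≡⟨ ∑-symmetrise (onCycle B) ⟨
    ∑[ i ≤ m ] ∑[ j ≤ m ] (onCycle B i j + onCycle B j i)
      -- One strict entry suffices: position (0, 0), where both summands are diagonal values at `v`.
      <⟨ ∑-mono-< (λ i → ∑-mono-≤ (λ j → sym≤ (c i) (c j)))
           (zero , ∑-mono-< (λ j → sym≤ v (c j))
                            (zero , +-mono-< (diag< v) (diag< v))) ⟩
    ∑[ i ≤ m ] ∑[ j ≤ m ] (onCycle A i j + onCycle A j i)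
                               ≡⟨ ∑-symmetrise (onCycle A) ⟩
    total A + total A          ≤⟨ +-mono-≤ total≤ total≤ ⟩
    total B + total B          ∎)
  where
  open ≤-Reasoning
  c : Fin (suc m) → V
  c i = fold v f (toℕ i)

  onCycle : (V → V → ℕ) → Fin (suc m) → Fin (suc m) → ℕ
  onCycle M i j = M (c i) (c j)

  total : (V → V → ℕ) → ℕ
  total M = ∑[ i ≤ m ] ∑[ j ≤ m ] onCycle M i j

  total≤ : total A ≤ total B
  total≤ = begin
    total A
      -- Only the row index is shifted; `period` identifies row `suc m` with row 0.
      ≡⟨ ∑-shift (suc m) (λ k → ∑[ j ≤ m ] A (fold v f k) (c j))
                 (cong (λ u → ∑[ j ≤ m ] A u (c j)) period) ⟨
    ∑[ i ≤ m ] ∑[ j ≤ m ] A (f (c i)) (c j)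
      ≤⟨ ∑-mono-≤ (λ i → ∑-mono-≤ (λ j → shift≤ (c i) (c j))) ⟩
    total B ∎

indicator : ∀ {P : Set} → Dec P → ℕ
indicator P? = if does P? then 1 else 0

indicator-mono : ∀ {P Q : Set} (P? : Dec P) (Q? : Dec Q) →
                 (P → Q) → indicator P? ≤ indicator Q?
indicator-mono (no _)  Q?      P⇒Q = z≤n
indicator-mono (yes p) (yes _) P⇒Q = ≤-refl
indicator-mono (yes p) (no ¬q) P⇒Q = contradiction (P⇒Q p) ¬q

indicator-< : ∀ {P Q : Set} (P? : Dec P) (Q? : Dec Q) →
              ¬ P → Q → indicator P? < indicator Q?
indicator-< (yes p) Q?      ¬p q = contradiction p ¬p
indicator-< (no _)  (yes _) ¬p q = ≤-refl
indicator-< (no _)  (no ¬q) ¬p q = contradiction q ¬q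

indicator-disjoint : ∀ {P Q : Set} (P? : Dec P) (Q? : Dec Q) →
                     ¬ (P × Q) → indicator P? + indicator Q? ≤ 1
indicator-disjoint (no _)  (no _)  ¬pq = z≤n
indicator-disjoint (no _)  (yes _) ¬pq = ≤-refl
indicator-disjoint (yes _) (no _)  ¬pq = ≤-refl
indicator-disjoint (yes p) (yes q) ¬pq = contradiction (p , q) ¬pq

indicator-cover : ∀ {P Q : Set} (P? : Dec P) (Q? : Dec Q) →
                  P ⊎ Q → 1 ≤ indicator P? + indicator Q?
indicator-cover (yes _) _       p⊎q = s≤s z≤n
indicator-cover (no _)  (yes _) p⊎q = ≤-refl
indicator-cover (no ¬p) (no ¬q) p⊎q = contradiction p⊎q [ ¬p , ¬q ]′

module _ {n : ℕ} (T : Tournament n) where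

  compare : ∀ i j → i ≡ j ⊎ Edge T i j ⊎ Edge T j i
  compare i j with i ≟ j
  ... | yes i≡j = inj₁ i≡j
  ... | no  i≢j with exactlyOne T i j i≢j
  ...   | inj₁ (ij , _) = inj₂ (inj₁ ij)
  ...   | inj₂ (ji , _) = inj₂ (inj₂ ji)

  asymmetric : ∀ i j → ¬ (Edge T i j × Edge T j i)
  asymmetric i j (ij , ji) with i ≟ j
  ... | yes refl = loopless T i ij
  ... | no  i≢j with exactlyOne T i j i≢j
  ...   | inj₁ (_ , ¬ji) = ¬ji ji
  ...   | inj₂ (_ , ¬ij) = ¬ij ij

  -- `exactlyOne` yields an orientation as data, and either orientation refutes its reverse. This
  -- makes the indicators and the search for μ computable.
  edge? : Decidable (Edge T)
  edge? i j with compare i j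
  ... | inj₁ refl      = no (loopless T i)
  ... | inj₂ (inj₁ ij) = yes ij
  ... | inj₂ (inj₂ ji) = no λ ij → asymmetric i j (ij , ji)

  _⊒_ : Fin n → Fin n → Set
  i ⊒ j = i ≡ j ⊎ Edge T i j

  _⊒?_ : Decidable _⊒_
  i ⊒? j = (i ≟ j) ⊎-dec edge? i j

  ⊒-total : ∀ i j → i ⊒ j ⊎ j ⊒ i
  ⊒-total i j with compare i j
  ... | inj₁ i≡j       = inj₁ (inj₁ i≡j)
  ... | inj₂ (inj₁ ij) = inj₁ (inj₂ ij)
  ... | inj₂ (inj₂ ji) = inj₂ (inj₂ ji)

module _ {n : ℕ} (T₁ T₂ : Tournament n) where

  _⇒?_ : Decidable (λ i j → i ⇒[ T₁ , T₂ ] j)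
  i ⇒? j = (i ≟ j) ⊎-dec edge? T₁ i j ⊎-dec edge? T₂ i j ⊎-dec
           any? (λ k → edge? T₁ i k ×-dec edge? T₂ k j)

  -- If μ does not beat v in `T₂`, then v = μ or v → μ there. Crossed with the two ways to have i ⊒
  -- v, this gives exactly the four disjuncts of i ⇒ μ.
  ⇏⇒out-neighbourhood-⊆ : ∀ {i μ} → ¬ i ⇒[ T₁ , T₂ ] μ →
    ∀ v → _⊒_ T₁ i v → Edge T₂ μ v
  ⇏⇒out-neighbourhood-⊆ {i} {μ} i⇏μ v i⊒v with compare T₂ μ v | i⊒v
  ... | inj₂ (inj₁ μv) | _         = μv
  ... | inj₁ refl      | inj₁ i≡μ  = contradiction (inj₁ i≡μ) i⇏μ
  ... | inj₁ refl      | inj₂ iμ   = contradiction (inj₂ (inj₁ iμ)) i⇏μ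
  ... | inj₂ (inj₂ vμ) | inj₁ refl = contradiction (inj₂ (inj₂ (inj₁ vμ))) i⇏μ
  ... | inj₂ (inj₂ vμ) | inj₂ iv   =
    contradiction (inj₂ (inj₂ (inj₂ (v , iv , vμ)))) i⇏μ

  no-cycle-of-⇏ : (f : Fin n → Fin n) → (∀ μ → ¬ f μ ⇒[ T₁ , T₂ ] μ) →
                  ∀ v m → ¬ fold v f (suc m) ≡ v
  no-cycle-of-⇏ f f⇏ = no-shifted-domination
    (λ u v → indicator (_⊒?_ T₁ u v)) (λ u v → indicator (edge? T₂ u v))
    -- The two sides are separated by 1: `T₂` has at most one of the two edges, while the reflexive
    -- closure of `T₁` relates every pair, equal vertices included.
    (λ u v → ≤-trans
      (indicator-disjoint (edge? T₂ u v) (edge? T₂ v u) (asymmetric T₂ u v))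
      (indicator-cover (_⊒?_ T₁ u v) (_⊒?_ T₁ v u) (⊒-total T₁ u v)))
    (λ v → indicator-< (edge? T₂ v v) (_⊒?_ T₁ v v) (loopless T₂ v) (inj₁ refl))
    f
    (λ u v → indicator-mono (_⊒?_ T₁ (f u) v) (edge? T₂ u v)
                            (⇏⇒out-neighbourhood-⊆ (f⇏ u) v))

corollary2 : (n : ℕ) → n ≥ 1 → (T₁ T₂ : Tournament n) →
    ∃[ μ ] ((i : Fin n) → i ⇒[ T₁ , T₂ ] μ)
corollary2 (suc n) _ T₁ T₂ with any? (λ μ → all? (λ i → _⇒?_ T₁ T₂ i μ))
... | yes found = found
... | no  ¬found =
  -- The walk can start at `zero` because the vertex set is nonempty.
  let v , m , period = periodicPoint (proj₁ ∘ witness) zero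
  in contradiction period (no-cycle-of-⇏ T₁ T₂ (proj₁ ∘ witness) (proj₂ ∘ witness) v m)
  where
  -- Decidability of ⇒ on a finite set turns the failure at μ into an explicit vertex, so no choice
  -- principle is invoked.
  witness : ∀ μ → ∃[ i ] (¬ i ⇒[ T₁ , T₂ ] μ)
  witness μ = ¬∀⟶∃¬ (suc n) _ (λ i → _⇒?_ T₁ T₂ i μ) (λ all → ¬found (μ , all))
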